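{- The logic $\mathbf{RmbC}$ is definable within the minimal bimodal logic $\mathbf E\oplus\mathbf E$ in the following sense: for every $\Gamma\cup\{\varphi\}\subseteq For(\Sigma)$, $\Gamma\vdash_{\mathbf{RmbC}}\varphi$ if and only if $\Gamma^t\vdash_{\mathbf E\oplus\mathbf E}\varphi^t$, where $\Gamma^t=\{\psi^t:\psi\in\Gamma\}$.
   Context: Let $\Sigma=\{\wedge,\vee,\to,\neg,\circ\}$ ($\neg,\circ$ unary) and $\Sigma_{bm}=\{\wedge,\vee,\to,\sim,\square_1,\lozenge_1,\square_2,\lozenge_2\}$ ($\sim,\square_i,\lozenge_i$ unary). For a signature $\Theta$, $For(\Theta)$ is the set of formulas over $\Theta$ generated by a fixed denumerable set $\mathcal V$ of propositional variables. $\alpha\leftrightarrow\beta$ abbreviates $(\alpha\to\beta)\wedge(\beta\to\alpha)$. $\mathbf{CPL}^+$ (positive classical logic) has axiom schemas: (Ax1) $\alpha\to(\beta\to\alpha)$; (Ax2) $(\alpha\to(\beta\to\gamma))\to((\alpha\to\beta)\to(\alpha\to\gamma))$; (Ax3) $\alpha\to(\beta\to(\alpha\wedge\beta))$; (Ax4) $(\alpha\wedge\beta)\to\alpha$; (Ax5) $(\alpha\wedge\beta)\to\beta$; (Ax6) $\alpha\to(\alpha\vee\beta)$; (Ax7) $\beta\to(\alpha\vee\beta)$; (Ax8) $(\alpha\to\gamma)\to((\beta\to\gamma)\to((\alpha\vee\beta)\to\gamma))$; (Ax9) $(\alpha\to\beta)\vee\alpha$; and the rule (MP): from $\alpha$ and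 $\alpha\to\beta$ infer $\beta$. $\mathbf{RmbC}$, over $\Sigma$, is $\mathbf{CPL}^+$ plus the schemas (Ax10) $\alpha\vee\neg\alpha$ and (bc1) $\circ\alpha\to(\alpha\to(\neg\alpha\to\beta))$, and the rules $(\mathbf R_\neg)$: from $\alpha\leftrightarrow\beta$ infer $\neg\alpha\leftrightarrow\neg\beta$; $(\mathbf R_\circ)$: from $\alpha\leftrightarrow\beta$ infer $\circ\alpha\leftrightarrow\circ\beta$. $\mathbf E\oplus\mathbf E$, over $\Sigma_{bm}$, is $\mathbf{CPL}^+$ plus the schemas (PEM) $\alpha\vee{\sim}\alpha$; (exp) $\alpha\to({\sim}\alpha\to\beta)$; (AxMod$_i$) $\lozenge_i\alpha\leftrightarrow{\sim}\square_i{\sim}\alpha$ for $i=1,2$; and the rules: from $\alpha\leftrightarrow\beta$ infer $\square_i\alpha\leftrightarrow\square_i\beta$, for $i=1,2$. In both logics, $\varphi$ is a theorem ($\vdash\varphi$) if there is a finite sequence of formulas ending in $\varphi$ each of which is an instance of an axiom schema or follows from earlier formulas of the sequence by a rule; and $\Gamma\vdash\varphi$ means that either $\vdash\varphi$ or there is a finite non-empty $\{\gamma_1,\dots,\gamma_n\}\subseteq\Gamma$ with $\vdash(\gamma_1\wedge(\gamma_2\wedge(\cdots\wedge(\gamma_{n-1}\wedge\gamma_n)\cdots)))\to\varphi$. The translation $t:For(\Sigma)\to For(\Sigma_{bm})$ is: $p^t=p$ for $p\in\mathcal V$; $(\varphi\#\psi)^t=\varphi^t\#\psi^t$ for $\#\in\{\wedge,\vee,\to\}$;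 $(\neg\varphi)^t=\varphi^t\to\square_1\varphi^t$; $(\circ\varphi)^t={\sim}(\varphi^t\wedge\square_1\varphi^t)\wedge\square_2\varphi^t$. -}

module Defs where

open import Data.List.Base using (List; []; _∷_)
open import Data.List.Membership.Propositional as Listₘ using ()
open import Data.List.NonEmpty.Base using (List⁺; foldr₁)
open import Data.List.NonEmpty.Relation.Unary.All using (All)
open import Data.Nat.Base using (ℕ)
open import Data.Product.Base using (∃-syntax; _×_)
open import Data.Sum.Base using (_⊎_)
open import Level using (Level; 0ℓ)
open import Relation.Binary.Core using (Rel)
open import Relation.Binary.PropositionalEquality.Core using (_≡_)
open import Relation.Unary using (Pred; _∈_)

private
  variable
    ℓ : Level

-- Both signatures share the binary connectives ∧, ∨, →, so a signature is
-- given by its type U of unary connectives alone.  The propositional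
-- variables are indexed by ℕ.

infixr 8 _∧_
infixr 7 _∨_
infixr 6 _⇒_
infix  5 _⟷_

data For (U : Set) : Set where
  var         : ℕ → For U
  _∧_ _∨_ _⇒_ : For U → For U → For U
  unary       : U → For U → For U

_⟷_ : ∀ {U} → For U → For U → For U
α ⟷ β = (α ⇒ β) ∧ (β ⇒ α)

data UnaryΣ : Set where
  neg circ : UnaryΣ

ForΣ : Set
ForΣ = For UnaryΣ

infix 9 ¬_ ∘_
pattern ¬_ α = unary neg α
pattern ∘_ α = unary circ α

data Index : Set where
  ι₁ ι₂ : Index

data UnaryBM : Set where
  cneg    : UnaryBM
  box dia : Index → UnaryBM

ForBM : Set
ForBM = For UnaryBM

infix 9 ∼_ □[_]_ ◇[_]_
pattern ∼_ α      = unary cneg α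
pattern □[_]_ i α = unary (box i) α
pattern ◇[_]_ i α = unary (dia i) α

-- A Hilbert calculus: modus ponens is always available, and every further
-- rule has a single premise; Rule α β reads "from α infer β".

record Logic (U : Set) : Set₁ where
  field
    Axiom : Pred (For U) 0ℓ
    Rule  : Rel (For U) 0ℓ

module _ {U : Set} (L : Logic U) where
  open Logic L

  data Justified (earlier : List (For U)) : Pred (For U) 0ℓ where
    axiom : ∀ {α} → Axiom α → Justified earlier α
    mp    : ∀ {α β} → α Listₘ.∈ earlier → (α ⇒ β) Listₘ.∈ earlier →
            Justified earlier β
    rule  : ∀ {α β} → α Listₘ.∈ earlier → Rule α β → Justified earlier β

  -- Sequences are listed with the last formula at the head.
  data Derivation : Pred (List (For U)) 0ℓ where
    []  : Derivation []
    _∷_ : ∀ {α αs} → Justified αs α → Derivation αs → Derivation (α ∷ αs)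

  Theorem : Pred (For U) 0ℓ
  Theorem φ = ∃[ αs ] Derivation (φ ∷ αs)

⋀ : ∀ {U} → List⁺ (For U) → For U
⋀ = foldr₁ _∧_

-- A finite non-empty {γ₁,…,γₙ} ⊆ Γ is given by an enumeration γs, possibly
-- with repetitions.  The rules of L apply to theorems only, never to
-- members of Γ.
infix 4 _⊢[_]_
_⊢[_]_ : ∀ {U} → Pred (For U) ℓ → Logic U → For U → Set ℓ
Γ ⊢[ L ] φ = Theorem L φ ⊎ (∃[ γs ] All Γ γs × Theorem L (⋀ γs ⇒ φ))

data CPL⁺ {U : Set} : Pred (For U) 0ℓ where
  Ax1 : ∀ α β → CPL⁺ (α ⇒ (β ⇒ α))
  Ax2 : ∀ α β γ → CPL⁺ ((α ⇒ (β ⇒ γ)) ⇒ ((α ⇒ β) ⇒ (α ⇒ γ)))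
  Ax3 : ∀ α β → CPL⁺ (α ⇒ (β ⇒ (α ∧ β)))
  Ax4 : ∀ α β → CPL⁺ ((α ∧ β) ⇒ α)
  Ax5 : ∀ α β → CPL⁺ ((α ∧ β) ⇒ β)
  Ax6 : ∀ α β → CPL⁺ (α ⇒ (α ∨ β))
  Ax7 : ∀ α β → CPL⁺ (β ⇒ (α ∨ β))
  Ax8 : ∀ α β γ → CPL⁺ ((α ⇒ γ) ⇒ ((β ⇒ γ) ⇒ ((α ∨ β) ⇒ γ)))
  Ax9 : ∀ α β → CPL⁺ ((α ⇒ β) ∨ α)

data RmbCAxiom : Pred ForΣ 0ℓ where
  cpl⁺ : ∀ {α} → CPL⁺ α → RmbCAxiom α
  Ax10 : ∀ α → RmbCAxiom (α ∨ ¬ α)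
  bc1  : ∀ α β → RmbCAxiom (∘ α ⇒ (α ⇒ (¬ α ⇒ β)))

data RmbCRule : Rel ForΣ 0ℓ where
  R¬ : ∀ α β → RmbCRule (α ⟷ β) (¬ α ⟷ ¬ β)
  R∘ : ∀ α β → RmbCRule (α ⟷ β) (∘ α ⟷ ∘ β)

RmbC : Logic UnaryΣ
RmbC = record { Axiom = RmbCAxiom ; Rule = RmbCRule }

data E⊕EAxiom : Pred ForBM 0ℓ where
  cpl⁺  : ∀ {α} → CPL⁺ α → E⊕EAxiom α
  PEM   : ∀ α → E⊕EAxiom (α ∨ ∼ α)
  exp   : ∀ α β → E⊕EAxiom (α ⇒ (∼ α ⇒ β))
  AxMod : ∀ i α → E⊕EAxiom (◇[ i ] α ⟷ ∼ □[ i ] ∼ α)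

data E⊕ERule : Rel ForBM 0ℓ where
  R□ : ∀ i α β → E⊕ERule (α ⟷ β) (□[ i ] α ⟷ □[ i ] β)

E⊕E : Logic UnaryBM
E⊕E = record { Axiom = E⊕EAxiom ; Rule = E⊕ERule }

infix 10 _ᵗ
_ᵗ : ForΣ → ForBM
var p ᵗ   = var p
(φ ∧ ψ) ᵗ = φ ᵗ ∧ ψ ᵗ
(φ ∨ ψ) ᵗ = φ ᵗ ∨ ψ ᵗ
(φ ⇒ ψ) ᵗ = φ ᵗ ⇒ ψ ᵗ
(¬ φ) ᵗ   = φ ᵗ ⇒ □[ ι₁ ] (φ ᵗ)
(∘ φ) ᵗ   = ∼ (φ ᵗ ∧ □[ ι₁ ] (φ ᵗ)) ∧ □[ ι₂ ] (φ ᵗ)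

image : {A B : Set} → (A → B) → Pred A ℓ → Pred B ℓ
image f P y = ∃[ x ] x ∈ P × f x ≡ y

-- The translation has an inverse up to provable equivalence.  RmbC has a
-- bottom formula ⊥ = ∘p ∧ (p ∧ ¬p), hence a classical negation α ⇒ ⊥, and its
-- connectives ¬ and ∘ satisfy the congruence rules of □₁ and □₂.  Reading ∼ as
-- this negation, □₁ as ¬ and □₂ as ∘ therefore turns theorems of E⊕E into
-- theorems of RmbC.  Composed with φ ↦ φᵗ it sends ¬α to α ⇒ ¬α, equivalent to
-- ¬α by excluded middle, and ∘α to ((α ∧ ¬α) ⇒ ⊥) ∧ ∘α, equivalent to ∘α by
-- (bc1).

{-# OPTIONS --safe #-}
module Submission where

open import Defs
open import Data.List.Base as List using (List; []; _∷_; _++_)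
open import Data.List.Membership.Propositional as Listₘ using ()
open import Data.List.Membership.Propositional.Properties using (∈-++⁺ˡ; ∈-++⁺ʳ)
open import Data.List.NonEmpty.Base using (_∷_; map)
open import Data.List.NonEmpty.Relation.Unary.All using (_∷_) renaming (All to All⁺)
open import Data.List.Relation.Unary.All as All using (All; []; _∷_)
open import Data.List.Relation.Unary.All.Properties using (map⁺)
open import Data.List.Relation.Unary.Any using (here; there)
open import Data.Product.Base using (∃-syntax; _×_; _,_)
open import Data.Sum.Base using (inj₁; inj₂)
open import Function.Bundles using (_⇔_; mk⇔)
open import Level using (Level)
open import Relation.Binary.PropositionalEquality.Core using (_≡_; refl; cong; subst; sym)
open import Relation.Unary using (Pred; _⊆_)

private
  variable
    ℓ : Level

module _ {U : Set} (L : Logic U) where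
  open Logic L

  module _ (P : Pred (For U) ℓ)
           (P-axiom : Axiom ⊆ P)
           (P-mp : ∀ {α β} → P α → P (α ⇒ β) → P β)
           (P-rule : ∀ {α β} → Rule α β → P α → P β) where

    -- The property is carried for every formula of the sequence, because the premises of a step may
    -- occur anywhere earlier and not only at its head.
    derivation-induction : Derivation L ⊆ All P
    derivation-induction []      = []
    derivation-induction (j ∷ d) = justified j ∷ ih
      where
      ih = derivation-induction d
      justified : ∀ {α} → Justified L _ α → P α
      justified (axiom a)  = P-axiom a
      justified (mp p q)   = P-mp (All.lookup ih p) (All.lookup ih q)
      justified (rule p r) = P-rule r (All.lookup ih p)

    theorem-induction : Theorem L ⊆ P
    theorem-induction (_ , d) = All.head (derivation-induction d)

  justified-++ : ∀ {αs βs} → Justified L αs ⊆ Justified L (αs ++ βs)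
  justified-++ (axiom a)  = axiom a
  justified-++ (mp p q)   = mp (∈-++⁺ˡ p) (∈-++⁺ˡ q)
  justified-++ (rule p r) = rule (∈-++⁺ˡ p) r

  -- Two theorems come with unrelated sequences; stacking them brings both premises of modus ponens
  -- into a single one.
  derivation-++ : ∀ {αs βs} → Derivation L αs → Derivation L βs → Derivation L (αs ++ βs)
  derivation-++ []      e = e
  derivation-++ (j ∷ d) e = justified-++ j ∷ derivation-++ d e

  theorem-axiom : Axiom ⊆ Theorem L
  theorem-axiom a = [] , axiom a ∷ []

  theorem-mp : ∀ {α β} → Theorem L α → Theorem L (α ⇒ β) → Theorem L β
  theorem-mp {α} {β} (αs , d) (βs , e) =
    (α ⇒ β ∷ βs) ++ (α ∷ αs) ,
    mp (∈-++⁺ʳ (α ⇒ β ∷ βs) (here refl)) (here refl) ∷ derivation-++ e d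

  theorem-rule : ∀ {α β} → Rule α β → Theorem L α → Theorem L β
  theorem-rule r (_ , d) = _ , rule (here refl) r ∷ d

module PositiveLogic {U : Set} (L : Logic U) (cpl : CPL⁺ ⊆ Logic.Axiom L) where

  infix  4 _⊢_
  infixl 9 _·_

  -- Only modus ponens acts under hypotheses. The rules of `L` enter solely through `thm`, as parts
  -- of closed theorems, so the deduction theorem never meets a rule applied to a hypothesis.
  data _⊢_ (Δ : List (For U)) : For U → Set where
    hyp : ∀ {α} → α Listₘ.∈ Δ → Δ ⊢ α
    thm : ∀ {α} → Theorem L α → Δ ⊢ α
    _·_ : ∀ {α β} → Δ ⊢ α ⇒ β → Δ ⊢ α → Δ ⊢ β

  private
    variable
      α α′ β β′ γ : For U
      Δ : List (For U)

  cplᵀ : CPL⁺ α → Δ ⊢ α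
  cplᵀ a = thm (theorem-axiom L (cpl a))

  closed : [] ⊢ α → Theorem L α
  closed (thm t) = t
  closed (p · q) = theorem-mp L (closed q) (closed p)

  -- The deduction theorem by bracket abstraction, with `Ax1` as K and `Ax2` as S; the discharged
  -- hypothesis itself becomes SKK.
  lam : α ∷ Δ ⊢ β → Δ ⊢ α ⇒ β
  lam {α} (hyp (here refl))     = cplᵀ (Ax2 α (α ⇒ α) α) · cplᵀ (Ax1 α (α ⇒ α)) · cplᵀ (Ax1 α α)
  lam {α} {β = β} (hyp (there p)) = cplᵀ (Ax1 β α) · hyp p
  lam {α} {β = β} (thm t)         = cplᵀ (Ax1 β α) · thm t
  lam {α} {β = β} (_·_ {γ} p q)   = cplᵀ (Ax2 α γ β) · lam p · lam q

  #0 : α ∷ Δ ⊢ α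
  #0 = hyp (here refl)

  #1 : β ∷ α ∷ Δ ⊢ α
  #1 = hyp (there (here refl))

  #2 : γ ∷ β ∷ α ∷ Δ ⊢ α
  #2 = hyp (there (there (here refl)))

  pair : Δ ⊢ α → Δ ⊢ β → Δ ⊢ α ∧ β
  pair p q = cplᵀ (Ax3 _ _) · p · q

  fst : Δ ⊢ α ∧ β → Δ ⊢ α
  fst p = cplᵀ (Ax4 _ _) · p

  snd : Δ ⊢ α ∧ β → Δ ⊢ β
  snd p = cplᵀ (Ax5 _ _) · p

  inl : Δ ⊢ α → Δ ⊢ α ∨ β
  inl p = cplᵀ (Ax6 _ _) · p

  inr : Δ ⊢ β → Δ ⊢ α ∨ β
  inr p = cplᵀ (Ax7 _ _) · p

  cases : Δ ⊢ α ∨ β → α ∷ Δ ⊢ γ → β ∷ Δ ⊢ γ → Δ ⊢ γ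
  cases p q r = cplᵀ (Ax8 _ _ _) · lam q · lam r · p

  -- Both forms of excluded middle become instances of this: β is □₁α in the translation of `Ax10`,
  -- and ⊥ in the image of `PEM` under `ˢ`.
  ∨⇒-excluded-middle : ∀ α β → Theorem L (α ∨ (α ⇒ β))
  ∨⇒-excluded-middle α β = closed (cases (cplᵀ (Ax9 α β)) (inr #0) (inl #0))

  equivalence : α ∷ [] ⊢ β → β ∷ [] ⊢ α → Theorem L (α ⟷ β)
  equivalence p q = closed (pair (lam p) (lam q))

  to : Theorem L (α ⟷ β) → Δ ⊢ α → Δ ⊢ β
  to t p = fst (thm t) · p

  from : Theorem L (α ⟷ β) → Δ ⊢ β → Δ ⊢ α
  from t p = snd (thm t) · p

  ⟷-refl : ∀ α → Theorem L (α ⟷ α)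
  ⟷-refl α = equivalence #0 #0

  ∧-cong : Theorem L (α ⟷ α′) → Theorem L (β ⟷ β′) → Theorem L ((α ∧ β) ⟷ (α′ ∧ β′))
  ∧-cong s t = equivalence (pair (to s (fst #0)) (to t (snd #0)))
                           (pair (from s (fst #0)) (from t (snd #0)))

  ∨-cong : Theorem L (α ⟷ α′) → Theorem L (β ⟷ β′) → Theorem L ((α ∨ β) ⟷ (α′ ∨ β′))
  ∨-cong s t = equivalence (cases #0 (inl (to s #0)) (inr (to t #0)))
                           (cases #0 (inl (from s #0)) (inr (from t #0)))

  ⇒-cong : Theorem L (α ⟷ α′) → Theorem L (β ⟷ β′) → Theorem L ((α ⇒ β) ⟷ (α′ ⇒ β′))
  ⇒-cong s t = equivalence (lam (to t (#1 · from s #0))) (lam (from t (#1 · to s #0)))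

module Translation where
  open PositiveLogic E⊕E cpl⁺

  □-cong : ∀ i {α β} → Theorem E⊕E (α ⟷ β) → Theorem E⊕E (□[ i ] α ⟷ □[ i ] β)
  □-cong i = theorem-rule E⊕E (R□ i _ _)

  explode : ∀ {Δ α β} → Δ ⊢ α → Δ ⊢ ∼ α → Δ ⊢ β
  explode p q = thm (theorem-axiom E⊕E (exp _ _)) · p · q

  -- No rule of the calculus gives this. `PEM` and `exp` make ∼ a classical negation, so
  -- contraposition is derivable.
  ∼-cong : ∀ {α β} → Theorem E⊕E (α ⟷ β) → Theorem E⊕E (∼ α ⟷ ∼ β)
  ∼-cong t = equivalence (cases (thm (theorem-axiom E⊕E (PEM _))) (explode (from t #0) #1) #0)
                         (cases (thm (theorem-axiom E⊕E (PEM _))) (explode (to t #0) #1) #0)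

  ᵗ-CPL⁺ : ∀ {φ} → CPL⁺ φ → CPL⁺ (φ ᵗ)
  ᵗ-CPL⁺ (Ax1 α β)   = Ax1 _ _
  ᵗ-CPL⁺ (Ax2 α β γ) = Ax2 _ _ _
  ᵗ-CPL⁺ (Ax3 α β)   = Ax3 _ _
  ᵗ-CPL⁺ (Ax4 α β)   = Ax4 _ _
  ᵗ-CPL⁺ (Ax5 α β)   = Ax5 _ _
  ᵗ-CPL⁺ (Ax6 α β)   = Ax6 _ _
  ᵗ-CPL⁺ (Ax7 α β)   = Ax7 _ _
  ᵗ-CPL⁺ (Ax8 α β γ) = Ax8 _ _ _
  ᵗ-CPL⁺ (Ax9 α β)   = Ax9 _ _

  ᵗ-axiom : ∀ {φ} → RmbCAxiom φ → Theorem E⊕E (φ ᵗ)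
  ᵗ-axiom (cpl⁺ a)  = theorem-axiom E⊕E (cpl⁺ (ᵗ-CPL⁺ a))
  ᵗ-axiom (Ax10 α)  = ∨⇒-excluded-middle _ _
  -- The hypotheses αᵗ and αᵗ → □₁αᵗ yield αᵗ ∧ □₁αᵗ, which the first conjunct of (∘α)ᵗ denies.
  ᵗ-axiom (bc1 α β) = closed (lam (lam (lam (explode (pair #1 (#0 · #1)) (fst #2)))))

  -- (¬α)ᵗ and (∘α)ᵗ are built from αᵗ by →, ∧, ∼ and the boxes, all of which respect provable
  -- equivalence.
  ᵗ-rule : ∀ {φ ψ} → RmbCRule φ ψ → Theorem E⊕E (φ ᵗ) → Theorem E⊕E (ψ ᵗ)
  ᵗ-rule (R¬ α β) t = ⇒-cong t (□-cong ι₁ t)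
  ᵗ-rule (R∘ α β) t = ∧-cong (∼-cong (∧-cong t (□-cong ι₁ t))) (□-cong ι₂ t)

  ᵗ-theorem : ∀ {φ} → Theorem RmbC φ → Theorem E⊕E (φ ᵗ)
  ᵗ-theorem = theorem-induction RmbC (λ φ → Theorem E⊕E (φ ᵗ)) ᵗ-axiom (theorem-mp E⊕E) ᵗ-rule

module InverseTranslation where
  open PositiveLogic RmbC cpl⁺

  -- The variable is an arbitrary choice: by `bc1` any formula in its place would serve equally
  -- well.
  ⊥ : ForΣ
  ⊥ = ∘ var 0 ∧ (var 0 ∧ ¬ var 0)

  explode : ∀ {Δ α β} → Δ ⊢ ∘ α → Δ ⊢ α → Δ ⊢ ¬ α → Δ ⊢ β
  explode p q r = thm (theorem-axiom RmbC (bc1 _ _)) · p · q · r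

  ⊥-elim : ∀ {Δ β} → Δ ⊢ ⊥ → Δ ⊢ β
  ⊥-elim p = explode (fst p) (fst (snd p)) (snd (snd p))

  connective : Index → UnaryΣ
  connective ι₁ = neg
  connective ι₂ = circ

  connective-cong : ∀ i {α β} → Theorem RmbC (α ⟷ β) →
                    Theorem RmbC (unary (connective i) α ⟷ unary (connective i) β)
  connective-cong ι₁ = theorem-rule RmbC (R¬ _ _)
  connective-cong ι₂ = theorem-rule RmbC (R∘ _ _)

  infix 10 _ˢ
  _ˢ : ForBM → ForΣ
  var p ˢ      = var p
  (φ ∧ ψ) ˢ    = φ ˢ ∧ ψ ˢ
  (φ ∨ ψ) ˢ    = φ ˢ ∨ ψ ˢ
  (φ ⇒ ψ) ˢ    = φ ˢ ⇒ ψ ˢ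
  (∼ φ) ˢ      = φ ˢ ⇒ ⊥
  (□[ i ] φ) ˢ = unary (connective i) (φ ˢ)
  (◇[ i ] φ) ˢ = unary (connective i) (φ ˢ ⇒ ⊥) ⇒ ⊥

  ˢ-CPL⁺ : ∀ {φ} → CPL⁺ φ → CPL⁺ (φ ˢ)
  ˢ-CPL⁺ (Ax1 α β)   = Ax1 _ _
  ˢ-CPL⁺ (Ax2 α β γ) = Ax2 _ _ _
  ˢ-CPL⁺ (Ax3 α β)   = Ax3 _ _
  ˢ-CPL⁺ (Ax4 α β)   = Ax4 _ _
  ˢ-CPL⁺ (Ax5 α β)   = Ax5 _ _
  ˢ-CPL⁺ (Ax6 α β)   = Ax6 _ _
  ˢ-CPL⁺ (Ax7 α β)   = Ax7 _ _
  ˢ-CPL⁺ (Ax8 α β γ) = Ax8 _ _ _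
  ˢ-CPL⁺ (Ax9 α β)   = Ax9 _ _

  ˢ-axiom : ∀ {φ} → E⊕EAxiom φ → Theorem RmbC (φ ˢ)
  ˢ-axiom (cpl⁺ a)    = theorem-axiom RmbC (cpl⁺ (ˢ-CPL⁺ a))
  ˢ-axiom (PEM α)     = ∨⇒-excluded-middle _ _
  ˢ-axiom (exp α β)   = closed (lam (lam (⊥-elim (#0 · #1))))
  -- The clause of `ˢ` for ◇ is the image of ∼□∼ written out, so the two sides are the same formula.
  ˢ-axiom (AxMod i α) = ⟷-refl _

  ˢ-rule : ∀ {φ ψ} → E⊕ERule φ ψ → Theorem RmbC (φ ˢ) → Theorem RmbC (ψ ˢ)
  ˢ-rule (R□ i α β) = connective-cong i

  ˢ-theorem : ∀ {φ} → Theorem E⊕E φ → Theorem RmbC (φ ˢ)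
  ˢ-theorem = theorem-induction E⊕E (λ φ → Theorem RmbC (φ ˢ)) ˢ-axiom (theorem-mp RmbC) ˢ-rule

  ᵗˢ-equivalent : ∀ φ → Theorem RmbC (φ ᵗ ˢ ⟷ φ)
  ᵗˢ-equivalent (var p) = ⟷-refl (var p)
  ᵗˢ-equivalent (φ ∧ ψ) = ∧-cong (ᵗˢ-equivalent φ) (ᵗˢ-equivalent ψ)
  ᵗˢ-equivalent (φ ∨ ψ) = ∨-cong (ᵗˢ-equivalent φ) (ᵗˢ-equivalent ψ)
  ᵗˢ-equivalent (φ ⇒ ψ) = ⇒-cong (ᵗˢ-equivalent φ) (ᵗˢ-equivalent ψ)
  ᵗˢ-equivalent (¬ φ)   =
    equivalence
      -- Excluded middle is taken for φ. If φ holds, so does its equivalent φᵗˢ, and the assumed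
      -- implication yields ¬φᵗˢ, hence ¬φ.
      (cases (thm (theorem-axiom RmbC (Ax10 φ))) (to ¬-equivalent (#1 · from ih #0)) #0)
      (lam (from ¬-equivalent #1))
    where
    ih = ᵗˢ-equivalent φ
    ¬-equivalent = connective-cong ι₁ ih
  ᵗˢ-equivalent (∘ φ)   =
    equivalence
      (to ∘-equivalent (snd #0))
      -- The contradiction concerns φᵗˢ, so ∘φ is first moved across the congruence for ∘; `bc1`
      -- then yields ⊥.
      (pair (lam (explode (from ∘-equivalent #1) (fst #0) (snd #0))) (from ∘-equivalent #0))
    where
    ∘-equivalent = connective-cong ι₂ (ᵗˢ-equivalent φ)

  ᵗ-theorem⁻¹ : ∀ {φ} → Theorem E⊕E (φ ᵗ) → Theorem RmbC φ
  ᵗ-theorem⁻¹ {φ} t = closed (to (ᵗˢ-equivalent φ) (thm (ˢ-theorem t)))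

-- This makes an implication from translated premises the translation of a single formula, which
-- reduces consequence to theoremhood.
⋀-map-ᵗ : ∀ γ γs → ⋀ (map _ᵗ (γ ∷ γs)) ≡ ⋀ (γ ∷ γs) ᵗ
⋀-map-ᵗ γ []       = refl
⋀-map-ᵗ γ (δ ∷ δs) = cong (γ ᵗ ∧_) (⋀-map-ᵗ δ δs)

module _ {A B : Set} (f : A → B) (P : Pred A ℓ) where

  ∈-image : ∀ {x} → P x → image f P (f x)
  ∈-image p = _ , p , refl

  All⁺-image⁺ : ∀ {xs} → All⁺ P xs → All⁺ (image f P) (map f xs)
  All⁺-image⁺ (p ∷ ps) = ∈-image p ∷ map⁺ (All.map ∈-image ps)

  All-image⁻ : ∀ {ys} → All (image f P) ys → ∃[ xs ] All P xs × List.map f xs ≡ ys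
  All-image⁻ []                    = [] , [] , refl
  All-image⁻ ((x , p , refl) ∷ qs) with xs , ps , refl ← All-image⁻ qs =
    x ∷ xs , p ∷ ps , refl

  -- Each membership in the image carries its own preimage, so a matching list of original premises
  -- can be read off.
  All⁺-image⁻ : ∀ {ys} → All⁺ (image f P) ys → ∃[ xs ] All⁺ P xs × map f xs ≡ ys
  All⁺-image⁻ ((x , p , refl) ∷ qs) with xs , ps , refl ← All-image⁻ qs =
    x ∷ xs , p ∷ ps , refl

theorem5p14 : ∀ {ℓ : Level} (Γ : Pred ForΣ ℓ) (φ : ForΣ) → (Γ ⊢[ RmbC ] φ) ⇔ (image _ᵗ Γ ⊢[ E⊕E ] φ ᵗ)
theorem5p14 Γ φ = mk⇔ translate reflect
  where
  open Translation using (ᵗ-theorem)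
  open InverseTranslation using (ᵗ-theorem⁻¹)

  translate : Γ ⊢[ RmbC ] φ → image _ᵗ Γ ⊢[ E⊕E ] φ ᵗ
  translate (inj₁ t) = inj₁ (ᵗ-theorem t)
  translate (inj₂ (γ ∷ γs , γs⊆Γ , t)) =
    inj₂ (map _ᵗ (γ ∷ γs) , All⁺-image⁺ _ᵗ Γ γs⊆Γ ,
          subst (λ α → Theorem E⊕E (α ⇒ φ ᵗ)) (sym (⋀-map-ᵗ γ γs)) (ᵗ-theorem t))

  reflect : image _ᵗ Γ ⊢[ E⊕E ] φ ᵗ → Γ ⊢[ RmbC ] φ
  reflect (inj₁ t) = inj₁ (ᵗ-theorem⁻¹ t)
  reflect (inj₂ (_ , γs⊆Γᵗ , t)) with γ ∷ γs , γs⊆Γ , refl ← All⁺-image⁻ _ᵗ Γ γs⊆Γᵗ =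
    inj₂ (γ ∷ γs , γs⊆Γ , ᵗ-theorem⁻¹ (subst (λ α → Theorem E⊕E (α ⇒ φ ᵗ)) (⋀-map-ᵗ γ γs) t))
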